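{- Fix an integer base $b\ge2$. Let $0.a_1a_2a_3\dots\in[0,1)$ and suppose that for every $\epsilon>0$ there exists an increasing sequence $n_1<n_2<n_3<\dots$ of positive integers with asymptotic lower density greater than $1-\epsilon$ such that $0.a_{n_1}a_{n_2}a_{n_3}\dots$ is base-$b$ normal. Then $0.a_1a_2a_3\dots$ is base-$b$ normal.
   Context: For a digit sequence $(a_i)$ with $a_i\in\{0,\dots,b-1\}$, $0.a_1a_2a_3\dots$ is (base-$b$) normal if for every $k\ge1$ and every string $[d_1,\dots,d_k]$ of digits in $\{0,\dots,b-1\}$, $\lim_{n\to\infty}\frac{1}{n}\#\{0\le i\le n-1: a_{i+j}=d_j, j=1,\dots,k\}=b^{ -k}$. The asymptotic lower density of $A\subset\mathbb{N}$ is $\liminf_{N\to\infty}|A\cap[1,N]|/N$. -}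

module Defs where

open import Data.Nat using (ℕ; zero; suc; _+_; _^_; _≤_; _<_)
open import Data.Bool using (Bool; true; false; _∧_; if_then_else_)
open import Data.Fin using (Fin)
open import Data.Fin.Properties using () renaming (_≟_ to _≟ᶠ_)
import Data.Nat.Properties as ℕₚ
open import Data.Vec using (Vec; []; _∷_)
open import Data.Integer using (+_)
open import Data.Rational using (ℚ; 0ℚ; 1ℚ; _/_; _-_; _+_; ∣_∣) renaming (_<_ to _<ℚ_; _≤_ to _≤ℚ_)
open import Data.Product using (Σ; ∃; _×_)
open import Relation.Nullary.Decidable using (⌊_⌋)

-- A base-b digit sequence a₁ a₂ a₃ … is a function a : ℕ → Fin b;
-- the digit a_i is  a i  for i ≥ 1 (the value a 0 is ignored).
DigitSeq : ℕ → Set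
DigitSeq b = ℕ → Fin b

matchAt : {b k : ℕ} → DigitSeq b → ℕ → Vec (Fin b) k → Bool
matchAt a i []       = true
matchAt a i (d ∷ ds) = ⌊ a (suc i) ≟ᶠ d ⌋ ∧ matchAt a (suc i) ds

countBelow : (ℕ → Bool) → ℕ → ℕ
countBelow P zero    = zero
countBelow P (suc n) = (if P n then 1 else 0) Data.Nat.+ countBelow P n

occurrences : {b k : ℕ} → DigitSeq b → Vec (Fin b) k → ℕ → ℕ
occurrences a d n = countBelow (λ i → matchAt a i d) n

-- 1/m as a rational (only used with m = b^k ≥ 1)
recip : ℕ → ℚ
recip zero    = 0ℚ
recip (suc m) = + 1 / suc m

Normal : (b : ℕ) → DigitSeq b → Set
Normal b a =
  (k : ℕ) (d : Vec (Fin b) k) (ε : ℚ) → 0ℚ <ℚ ε →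
  Σ ℕ λ N → (m : ℕ) → N ≤ m →
    ∣ (+ occurrences a d (suc m) / suc m) - recip (b ^ k) ∣ <ℚ ε

-- An increasing sequence n₁ < n₂ < … of positive integers,
-- given as ν : ℕ → ℕ with n_i = ν i for i ≥ 1 (ν 0 ignored).
IncreasingPos : (ℕ → ℕ) → Set
IncreasingPos ν = (1 ≤ ν 1) × ((i : ℕ) → 1 ≤ i → ν i < ν (suc i))

-- membership of m in A = {n_i : i ≥ 1}. For an increasing sequence of
-- positive integers n_i ≥ i, so it suffices to search i ∈ [1, m].
inRange : (ℕ → ℕ) → ℕ → Bool
inRange ν m = search m
  where
  search : ℕ → Bool
  search zero    = false
  search (suc i) = ⌊ ν (suc i) ℕₚ.≟ m ⌋ Data.Bool.∨ search i

countUpTo : (ℕ → ℕ) → ℕ → ℕ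
countUpTo ν N = countBelow (λ m → inRange ν (suc m)) N

-- lower density of A strictly greater than c:
-- liminf_{N→∞} |A ∩ [1,N]|/N > c  ⇔  ∃ c' > c, eventually |A∩[1,N]|/N ≥ c'
LowerDensityGt : (ℕ → ℕ) → ℚ → Set
LowerDensityGt ν c =
  Σ ℚ λ c' → c <ℚ c' × Σ ℕ λ N₀ → (m : ℕ) → N₀ ≤ m →
    c' ≤ℚ (+ countUpTo ν (suc m) / suc m)

subseq : {b : ℕ} → DigitSeq b → (ℕ → ℕ) → DigitSeq b
subseq a ν i = a (ν i)

{-# OPTIONS --safe #-}
module Submission where

-- Let n₁ < n₂ < … have M terms and G gaps in [1, n], so M + G = n.
-- A window of length k+1 in a that contains no gap is also a window of
-- the subsequence, and each gap spoils at most k+1 windows.  Hence the occurrence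
-- counts of a string in a up to n and in the subsequence up to M differ by at most
-- (k+1)(G + k+1).  Choosing the density of the subsequence so close to 1 that G is a
-- tiny fraction of n, normality of the subsequence transfers to a up to any
-- prescribed accuracy.

open import Defs
open import Data.Nat using (ℕ; _≤_)
open import Data.Product using (Σ; _×_)
open import Data.Rational using (ℚ; 0ℚ; 1ℚ; _-_) renaming (_<_ to _<ℚ_)
open import Data.Bool using (Bool; true; false; not; if_then_else_; _∧_; _∨_)
open import Data.Fin using (Fin)
import Data.Fin.Properties as Fin
open import Data.Integer using (+_; +[1+_])
import Data.Integer as ℤ
import Data.Integer.Properties as ℤ
open import Data.Nat
  using (zero; suc; NonZero; _+_; _*_; _^_; _∸_; _⊔_; _<_; z≤n; s≤s; z<s; ∣_-_∣; _≟_; _≤?_; >-nonZero)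
open import Data.Nat.Properties hiding (_≟_; _≤?_)
open import Data.Nat.Tactic.RingSolver using (solve-∀)
open import Data.Product using (∃-syntax; _,_; proj₁; proj₂)
open import Data.Rational using (mkℚ; _/_; toℚᵘ) renaming (∣_∣ to ∣_∣ℚ)
import Data.Rational as ℚ
import Data.Rational.Properties as ℚ
open import Data.Rational.Unnormalised using (mkℚᵘ; _≃_; *<*)
import Data.Rational.Unnormalised as ℚᵘ
import Data.Rational.Unnormalised.Properties as ℚᵘ
open import Data.Vec using (Vec; []; _∷_)
open import Data.Sum using (_⊎_; inj₁; inj₂)
open import Function using (_∘_)
open import Relation.Binary.Definitions using (tri<; tri≈; tri>)
open import Relation.Nullary using (yes; no; contradiction)
open import Relation.Nullary.Decidable using (⌊_⌋)
open import Relation.Binary.PropositionalEquality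

-- Counting functions and sums over windows of them.

countBelow-complement : ∀ P n → countBelow P n + countBelow (not ∘ P) n ≡ n
countBelow-complement P zero = refl
countBelow-complement P (suc n) with P n
... | true  = cong suc (countBelow-complement P n)
... | false = trans (+-suc _ _) (cong suc (countBelow-complement P n))

countBelow-step : ∀ P n → countBelow P n ≤ countBelow P (suc n)
countBelow-step P n = m≤n+m _ (if P n then 1 else 0)

bit≤1 : ∀ x → (if x then 1 else 0) ≤ 1
bit≤1 true  = ≤-refl
bit≤1 false = z≤n

countBelow-≤-+ : ∀ P n k → countBelow P n ≤ countBelow P (n + k)
countBelow-≤-+ P n zero    = ≤-reflexive (cong (countBelow P) (sym (+-identityʳ n)))
countBelow-≤-+ P n (suc k) = ≤-trans (countBelow-≤-+ P n k)
  (subst (λ x → countBelow P (n + k) ≤ countBelow P x) (sym (+-suc n k)) (countBelow-step P (n + k)))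

countBelow-+-≤ : ∀ P n k → countBelow P (n + k) ≤ countBelow P n + k
countBelow-+-≤ P n zero    =
  ≤-reflexive (trans (cong (countBelow P) (+-identityʳ n)) (sym (+-identityʳ _)))
countBelow-+-≤ P n (suc k) = begin
  countBelow P (n + suc k)    ≡⟨ cong (countBelow P) (+-suc n k) ⟩
  countBelow P (suc (n + k))  ≤⟨ +-mono-≤ (bit≤1 (P (n + k))) (countBelow-+-≤ P n k) ⟩
  suc (countBelow P n + k)    ≡⟨ +-suc _ k ⟨
  countBelow P n + suc k      ∎
  where open ≤-Reasoning

-- The sum `G n + … + G (n + k - 1)`. Up to its value at 0, it is the telescoped sum of
-- `G (i + k) - G i` over `i < n`.
window : (ℕ → ℕ) → ℕ → ℕ → ℕ
window G zero    n = 0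
window G (suc k) n = G n + window G k (suc n)

-- Both sides are the sum of the k + 1 values from `G n` to `G (n + k)`.
window-telescope : ∀ G k n → window G k (suc n) + G n ≡ window G k n + G (n + k)
window-telescope G zero    n = cong G (sym (+-identityʳ n))
window-telescope G (suc k) n = begin
  G (suc n) + window G k (suc (suc n)) + G n    ≡⟨ cong (_+ G n) (+-comm (G (suc n)) _) ⟩
  window G k (suc (suc n)) + G (suc n) + G n    ≡⟨ cong (_+ G n) (window-telescope G k (suc n)) ⟩
  window G k (suc n) + G (suc n + k) + G n      ≡⟨ +-comm _ (G n) ⟩
  G n + (window G k (suc n) + G (suc n + k))    ≡⟨ +-assoc (G n) _ _ ⟨
  G n + window G k (suc n) + G (suc n + k)      ≡⟨ cong (λ x → G n + window G k (suc n) + G x) (+-suc n k) ⟨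
  G n + window G k (suc n) + G (n + suc k)      ∎
  where open ≡-Reasoning

-- Each of the k summands exceeds `countBelow P n` by less than k, since a count grows by at most
-- one per step.
window-≤ : ∀ P k n → window (countBelow P) k n ≤ k * (countBelow P n + k)
window-≤ P zero    n = z≤n
window-≤ P (suc k) n = +-mono-≤ (m≤m+n _ (suc k)) (begin
  window (countBelow P) k (suc n)    ≤⟨ window-≤ P k (suc n) ⟩
  k * (countBelow P (suc n) + k)     ≤⟨ *-monoʳ-≤ k (+-monoˡ-≤ k (+-monoˡ-≤ (countBelow P n) (bit≤1 (P n)))) ⟩
  k * (suc (countBelow P n) + k)     ≡⟨ cong (k *_) (+-suc _ k) ⟨
  k * (countBelow P n + suc k)       ∎)
  where open ≤-Reasoning

-- Increasing sequences and membership in their range.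

module _ {ν : ℕ → ℕ} (incr : IncreasingPos ν) where

  increasing-strict : ∀ {i} → 1 ≤ i → ∀ k → ν i < ν (suc k + i)
  increasing-strict {i} 1≤i zero    = proj₂ incr i 1≤i
  increasing-strict {i} 1≤i (suc k) =
    <-trans (increasing-strict 1≤i k) (proj₂ incr (suc k + i) (s≤s z≤n))

  increasing-< : ∀ {i j} → 1 ≤ i → i < j → ν i < ν j
  increasing-< {i} {j} 1≤i i<j = subst (λ x → ν i < ν x)
    (trans (sym (+-suc (j ∸ suc i) i)) (m∸n+n≡m i<j)) (increasing-strict 1≤i (j ∸ suc i))

  increasing-≥ : ∀ i → suc i ≤ ν (suc i)
  increasing-≥ zero    = proj₁ incr
  increasing-≥ (suc i) = ≤-trans (s≤s (increasing-≥ i)) (proj₂ incr (suc i) (s≤s z≤n))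

-- The search inside inRange is local to Defs and has no name here.  Abstracting
-- suc m in the unfolding of inRange ν (suc m) separates its two arguments, so
-- that unification can recover the function.
mutual
  searchUpTo : (ℕ → ℕ) → ℕ → ℕ → Bool
  searchUpTo = _

  inRange-suc : ∀ ν m → inRange ν (suc m) ≡ (⌊ ν (suc m) ≟ suc m ⌋ ∨ searchUpTo ν (suc m) m)
  inRange-suc ν m with suc m
  ... | w = refl

search-sound : ∀ ν m k → searchUpTo ν m k ≡ true → ∃[ i ] ν (suc i) ≡ m
search-sound ν m (suc k) eq with ν (suc k) ≟ m
... | yes νk≡m = k , νk≡m
... | no  _    = search-sound ν m k eq

search-complete : ∀ ν m k i → i < k → ν (suc i) ≡ m → searchUpTo ν m k ≡ true
search-complete ν m (suc k) i i<1+k νi≡m with ν (suc k) ≟ m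
... | yes _   = refl
... | no νk≢m = search-complete ν m k i (≤∧≢⇒< (≤-pred i<1+k) λ { refl → νk≢m νi≡m }) νi≡m

inRange-sound : ∀ ν m → inRange ν m ≡ true → ∃[ i ] ν (suc i) ≡ m
inRange-sound ν m = search-sound ν m m

-- The bounded search cannot stop too early: `ν (suc i)` is at least `suc i`, so the index of m is
-- at most m.
inRange-complete : ∀ {ν} → IncreasingPos ν → ∀ m i → ν (suc i) ≡ m → inRange ν m ≡ true
inRange-complete {ν} incr m i νi≡m =
  search-complete ν m m i (subst (i <_) νi≡m (increasing-≥ incr i)) νi≡m

-- Comparing occurrences in a sequence and in its subsequence.

bits-close : ∀ x y → ∣ (if x then 1 else 0) - (if y then 1 else 0) ∣ ≤ 1
bits-close true  true  = z≤n
bits-close true  false = ≤-refl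
bits-close false true  = ≤-refl
bits-close false false = z≤n

∣-∣-+-≤ : ∀ u x v y → ∣ u + x - v + y ∣ ≤ ∣ u - v ∣ + ∣ x - y ∣
∣-∣-+-≤ u x v y = begin
  ∣ u + x - v + y ∣                        ≤⟨ ∣-∣-triangle (u + x) (v + x) (v + y) ⟩
  ∣ u + x - v + x ∣ + ∣ v + x - v + y ∣
    ≡⟨ cong₂ _+_ (trans (cong₂ ∣_-_∣ (+-comm u x) (+-comm v x)) (∣m+n-m+o∣≡∣n-o∣ x u v))
                 (∣m+n-m+o∣≡∣n-o∣ v x y) ⟩
  ∣ u - v ∣ + ∣ x - y ∣                    ∎
  where open ≤-Reasoning

module Thinning
  {ν : ℕ → ℕ} (incr : IncreasingPos ν) (P : ℕ → Bool)
  (sound : ∀ n → P n ≡ true → ∃[ i ] ν (suc i) ≡ suc n)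
  (complete : ∀ n i → ν (suc i) ≡ suc n → P n ≡ true) where

  -- `P n` speaks of position n + 1, so these count the terms and the gaps among 1, ..., n.
  kept missed : ℕ → ℕ
  kept   = countBelow P
  missed = countBelow (not ∘ P)

  kept+missed : ∀ n → kept n + missed n ≡ n
  kept+missed = countBelow-complement P

  -- Pins k down as the value at n of the counting function of the sequence; terms are numbered from
  -- 1, hence `suc i`.
  Brackets : ℕ → ℕ → Set
  Brackets n k = (∀ i → i < k → ν (suc i) ≤ n) × n < ν (suc k)

  -- `sound` gives some term equal to n + 1. The first k terms are too small for it, and the terms
  -- after `ν (suc k)` are too large.
  brackets-hit : ∀ {n k} → Brackets n k → P n ≡ true → ν (suc k) ≡ suc n
  brackets-hit {n} {k} (below , above) Pn with sound n Pn
  ... | i , νi≡ with <-cmp i k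
  ...   | tri< i<k _ _    = contradiction (subst (_≤ n) νi≡ (below i i<k)) 1+n≰n
  ...   | tri≈ _ refl _   = νi≡
  ...   | tri> _ _ k<i    = contradiction
    (≤-trans (s≤s above) (subst (ν (suc k) <_) νi≡ (increasing-< incr (s≤s z≤n) (s≤s k<i)))) 1+n≰n

  -- Turns the count of hits into an index: the first term beyond n is `ν (suc (kept n))`. A hit
  -- moves the bracket on by one term; at a gap, `complete` keeps that term beyond n + 1.
  brackets : ∀ n → Brackets n (kept n)
  brackets zero = (λ _ ()) , proj₁ incr
  brackets (suc n) with brackets n | P n in Pn
  ... | below , above | true =
      (λ i i<1+k → case-≤ i (m≤n⇒m<n∨m≡n (≤-pred i<1+k)))
    , subst (_< ν (suc (suc (kept n)))) hit (proj₂ incr (suc (kept n)) (s≤s z≤n))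
    where
    hit : ν (suc (kept n)) ≡ suc n
    hit = brackets-hit (below , above) Pn
    case-≤ : ∀ i → i < kept n ⊎ i ≡ kept n → ν (suc i) ≤ suc n
    case-≤ i (inj₁ i<k)  = m≤n⇒m≤1+n (below i i<k)
    case-≤ i (inj₂ refl) = ≤-reflexive hit
  ... | below , above | false =
      (λ i i<k → m≤n⇒m≤1+n (below i i<k))
    , ≤∧≢⇒< above λ eq → contradiction (trans (sym (complete n (kept n) (sym eq))) Pn) λ ()

  kept-hit : ∀ n → P n ≡ true → ν (suc (kept n)) ≡ suc n
  kept-hit n = brackets-hit (brackets n)

  -- A gap at position n + 1 would raise `missed` at once, and by monotonicity it would stay raised.
  missed-const⇒hit : ∀ n k → missed (n + suc k) ≤ missed n → P n ≡ true
  missed-const⇒hit n k le = hit (P n) refl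
    where
    hit : ∀ x → P n ≡ x → P n ≡ true
    hit true  Pn = Pn
    hit false Pn = contradiction (≤-trans (≤-reflexive (sym missed-suc))
      (≤-trans (countBelow-≤-+ (not ∘ P) (suc n) k)
        (≤-trans (≤-reflexive (cong missed (sym (+-suc n k)))) le))) 1+n≰n
      where
      missed-suc : missed (suc n) ≡ suc (missed n)
      missed-suc rewrite Pn = refl

  kept-suc : ∀ n → P n ≡ true → kept (suc n) ≡ suc (kept n)
  kept-suc n Pn rewrite Pn = refl

  missed-suc-hit : ∀ n → P n ≡ true → missed (suc n) ≡ missed n
  missed-suc-hit n Pn rewrite Pn = refl

  module _ {b : ℕ} (a : DigitSeq b) where

    -- Without gaps among positions n + 1, ..., n + k, these positions are consecutive terms of `ν`,
    -- starting at index `kept n + 1`; the digits then agree one by one.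
    matchAt-subseq : ∀ {k} (d : Vec (Fin b) k) n → missed (n + k) ≤ missed n →
      matchAt (subseq a ν) (kept n) d ≡ matchAt a n d
    matchAt-subseq [] n le = refl
    matchAt-subseq {suc k} (c ∷ d) n le = cong₂ (λ i x → ⌊ a i Fin.≟ c ⌋ ∧ x)
      (kept-hit n Pn)
      (trans (cong (λ i → matchAt (subseq a ν) i d) (sym (kept-suc n Pn)))
        (matchAt-subseq d (suc n)
          (subst₂ _≤_ (cong missed (+-suc n k)) (sym (missed-suc-hit n Pn)) le)))
      where Pn = missed-const⇒hit n k le

    module _ {k : ℕ} (d : Vec (Fin b) k) where

      discrepancy : ℕ → ℕ
      discrepancy n = ∣ occurrences a d n - occurrences (subseq a ν) d (kept n) ∣

      discrepancy-suc-≤ : ∀ n → discrepancy (suc n) ≤ suc (discrepancy n)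
      discrepancy-suc-≤ n with P n
      ... | true  = ≤-trans
        (∣-∣-+-≤ (if matchAt a n d then 1 else 0) _ (if matchAt (subseq a ν) (kept n) d then 1 else 0) _)
        (+-monoˡ-≤ _ (bits-close (matchAt a n d) (matchAt (subseq a ν) (kept n) d)))
      -- At a gap the subsequence count stands still, so the bit is compared with 0.
      ... | false = ≤-trans
        (∣-∣-+-≤ (if matchAt a n d then 1 else 0) _ 0 _)
        (+-monoˡ-≤ _ (bits-close (matchAt a n d) false))

      -- Both counts advance, by the same bit. The gap-free stretch has length k + 1 so that
      -- position n + 1 is kept even for the empty string.
      discrepancy-const : ∀ n → missed (n + suc k) ≤ missed n → discrepancy (suc n) ≡ discrepancy n
      discrepancy-const n le = begin
        discrepancy (suc n)
          ≡⟨ cong (λ i → ∣ occurrences a d (suc n) - occurrences (subseq a ν) d i ∣)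
                  (kept-suc n (missed-const⇒hit n k le)) ⟩
        ∣ occurrences a d (suc n) - occurrences (subseq a ν) d (suc (kept n)) ∣
          ≡⟨ cong (λ x → ∣ occurrences a d (suc n) -
                           (if x then 1 else 0) + occurrences (subseq a ν) d (kept n) ∣)
                  (matchAt-subseq d n le′) ⟩
        ∣ occurrences a d (suc n) - (if matchAt a n d then 1 else 0) + occurrences (subseq a ν) d (kept n) ∣
          ≡⟨ ∣m+n-m+o∣≡∣n-o∣ (if matchAt a n d then 1 else 0) _ _ ⟩
        discrepancy n ∎
        where
        open ≡-Reasoning
        le′ : missed (n + k) ≤ missed n
        le′ = ≤-trans (countBelow-step (not ∘ P) (n + k))
                (≤-trans (≤-reflexive (cong missed (sym (+-suc n k)))) le)

      -- Summed over n, the missed terms telescope to a window sum, so the spoiled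
      -- windows need not be counted one gap at a time.
      discrepancy-step : ∀ n → discrepancy (suc n) + missed n ≤ discrepancy n + missed (n + suc k)
      discrepancy-step n with missed (n + suc k) ≤? missed n
      ... | yes le = +-mono-≤ (≤-reflexive (discrepancy-const n le)) (countBelow-≤-+ (not ∘ P) n (suc k))
      ... | no  gt = begin
        discrepancy (suc n) + missed n          ≤⟨ +-monoˡ-≤ _ (discrepancy-suc-≤ n) ⟩
        suc (discrepancy n) + missed n          ≡⟨ +-suc _ _ ⟨
        discrepancy n + suc (missed n)          ≤⟨ +-monoʳ-≤ _ (≰⇒> gt) ⟩
        discrepancy n + missed (n + suc k)      ∎
        where open ≤-Reasoning

      -- The window sum grows by exactly the allowance in `discrepancy-step`; carrying `missed n` on
      -- both sides avoids subtraction.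
      discrepancy≤window : ∀ n → discrepancy n ≤ window missed (suc k) n
      discrepancy≤window zero    = z≤n
      discrepancy≤window (suc n) = +-cancelʳ-≤ (missed n) _ _ (begin
        discrepancy (suc n) + missed n                  ≤⟨ discrepancy-step n ⟩
        discrepancy n + missed (n + suc k)              ≤⟨ +-monoˡ-≤ _ (discrepancy≤window n) ⟩
        window missed (suc k) n + missed (n + suc k)    ≡⟨ window-telescope missed (suc k) n ⟨
        window missed (suc k) (suc n) + missed n        ∎)
        where open ≤-Reasoning

      discrepancy-≤ : ∀ n → discrepancy n ≤ suc k * (missed n + suc k)
      discrepancy-≤ n = ≤-trans (discrepancy≤window n) (window-≤ (not ∘ P) (suc k) n)

-- Clearing denominators in normality and density.

toℚᵘ-homo-- : ∀ x y → toℚᵘ (x - y) ≃ toℚᵘ x ℚᵘ.- toℚᵘ y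
toℚᵘ-homo-- x y = ℚᵘ.≃-trans (ℚ.toℚᵘ-homo-+ x (ℚ.- y)) (ℚᵘ.+-congʳ (toℚᵘ x) (ℚ.toℚᵘ-homo‿- y))

∣⊖∣ : ∀ m n → ℤ.∣ m ℤ.⊖ n ∣ ≡ ∣ m - n ∣
∣⊖∣ m n with m ≤? n
... | yes m≤n = trans (ℤ.∣⊖∣-≤ m≤n) (sym (m≤n⇒∣m-n∣≡n∸m m≤n))
... | no  m≰n = trans (cong ℤ.∣_∣ (ℤ.⊖-≥ (<⇒≤ (≰⇒> m≰n)))) (sym (m≤n⇒∣n-m∣≡n∸m (<⇒≤ (≰⇒> m≰n))))

-- With n = m + 1 and q = r + 1 this is |o/n - 1/q| = |oq - n|/(nq); `mkℚᵘ` stores the denominator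
-- minus one, and nq - 1 is `r + m * suc r`.
frequency-distance : ∀ o m r → toℚᵘ ∣ + o / suc m - + 1 / suc r ∣ℚ ≃
  mkℚᵘ (+ ∣ o * suc r - suc m ∣) (r + m * suc r)
frequency-distance o m r = begin
  toℚᵘ ∣ + o / suc m - + 1 / suc r ∣ℚ           ≈⟨ ℚ.toℚᵘ-homo-∣-∣ (+ o / suc m - + 1 / suc r) ⟩
  ℚᵘ.∣ toℚᵘ (+ o / suc m - + 1 / suc r) ∣       ≈⟨ ℚᵘ.∣-∣-cong (toℚᵘ-homo-- (+ o / suc m) (+ 1 / suc r)) ⟩
  ℚᵘ.∣ toℚᵘ (+ o / suc m) ℚᵘ.- toℚᵘ (+ 1 / suc r) ∣
    ≈⟨ ℚᵘ.∣-∣-cong (ℚᵘ.+-cong (ℚ.toℚᵘ-fromℚᵘ (mkℚᵘ (+ o) m)) (ℚᵘ.-‿cong (ℚ.toℚᵘ-fromℚᵘ (mkℚᵘ (+ 1) r)))) ⟩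
  ℚᵘ.∣ mkℚᵘ (+ o) m ℚᵘ.- mkℚᵘ (+ 1) r ∣         ≡⟨ cong (λ x → mkℚᵘ (+ x) (r + m * suc r)) numerator ⟩
  mkℚᵘ (+ ∣ o * suc r - suc m ∣) (r + m * suc r) ∎
  where
  open ℚᵘ.≃-Reasoning
  numerator : ℤ.∣ + o ℤ.* + suc r ℤ.+ (ℤ.- + 1) ℤ.* + suc m ∣ ≡ ∣ o * suc r - suc m ∣
  numerator = trans
    (cong ℤ.∣_∣ (trans (cong₂ ℤ._+_ (sym (ℤ.pos-* o (suc r))) (ℤ.-1*i≡-i (+ suc m)))
                       (ℤ.m-n≡m⊖n (o * suc r) (suc m))))
    (∣⊖∣ (o * suc r) (suc m))

+*+< : ∀ {a b c d} → + a ℤ.* + b ℤ.< + c ℤ.* + d → a * b < c * d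
+*+< {a} {b} {c} {d} lt =
  ℤ.drop‿+<+ (subst₂ ℤ._<_ (sym (ℤ.pos-* a b)) (sym (ℤ.pos-* c d)) lt)

<⇒+*+< : ∀ {a b c d} → a * b < c * d → + a ℤ.* + b ℤ.< + c ℤ.* + d
<⇒+*+< {a} {b} {c} {d} lt = subst₂ ℤ._<_ (ℤ.pos-* a b) (ℤ.pos-* c d) (ℤ.+<+ lt)

-- The factor q in the tolerance cancels the q in the denominator of the distance.
frequency-<⇒count-< : ∀ o m q p .{{_ : NonZero q}} →
  ∣ + o / suc m - recip q ∣ℚ <ℚ recip (suc p * q) → suc p * ∣ o * q - suc m ∣ < suc m
frequency-<⇒count-< o m q@(suc r) p lt = *-cancelʳ-< (suc r) _ _ (begin-strict
  suc p * D * q      ≡⟨ regroup (suc p) D q ⟩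
  D * (suc p * q)    <⟨ +*+< {D} {suc p * q} {1} {suc m * q} (ℚᵘ.drop-*<* (ℚᵘ.<-respˡ-≃ (frequency-distance o m r)
                         (ℚᵘ.<-respʳ-≃ (ℚ.toℚᵘ-fromℚᵘ (mkℚᵘ (+ 1) (r + p * q))) (ℚ.toℚᵘ-mono-< lt)))) ⟩
  1 * (suc m * q)    ≡⟨ *-identityˡ _ ⟩
  suc m * q          ∎)
  where
  open ≤-Reasoning
  D = ∣ o * q - suc m ∣
  regroup : ∀ x y z → x * y * z ≡ y * (x * z)
  regroup = solve-∀

-- A positive rational is at least the reciprocal of its denominator, so only the denominator of `ε`
-- enters; a further factor 1/q is given away.
count-<⇒frequency-< : ∀ o m q ε .{{_ : NonZero q}} → 0ℚ <ℚ ε →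
  suc (ℚ.denominator-1 ε) * ∣ o * q - suc m ∣ < suc m → ∣ + o / suc m - recip q ∣ℚ <ℚ ε
count-<⇒frequency-< o m q@(suc r) (mkℚ (+ zero) y _) 0<ε lt = contradiction (ℚ.drop-*<* 0<ε) λ { (ℤ.+<+ ()) }
count-<⇒frequency-< o m q@(suc r) (mkℚ ℤ.-[1+ x ] y _) 0<ε lt = contradiction (ℚ.drop-*<* 0<ε) λ ()
count-<⇒frequency-< o m q@(suc r) (mkℚ +[1+ x ] y _) 0<ε lt =
  ℚ.toℚᵘ-cancel-< (ℚᵘ.<-respˡ-≃ (ℚᵘ.≃-sym (frequency-distance o m r))
    (*<* (<⇒+*+< {D} {suc y} {suc x} {suc m * q} (begin-strict
      D * suc y            ≡⟨ *-comm D (suc y) ⟩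
      suc y * D            <⟨ lt ⟩
      suc m                ≤⟨ m≤m*n (suc m) q ⟩
      suc m * q            ≤⟨ m≤n*m (suc m * q) (suc x) ⟩
      suc x * (suc m * q)  ∎))))
  where
  open ≤-Reasoning
  D = ∣ o * q - suc m ∣

-- |occ/n − 1/bᵏ| < 1/((p+1)bᵏ) with denominators cleared, where n = suc m.
CountNormal : (b : ℕ) → DigitSeq b → Set
CountNormal b a = (k : ℕ) (d : Vec (Fin b) k) (p : ℕ) →
  Σ ℕ λ N → (m : ℕ) → N ≤ m → suc p * ∣ occurrences a d (suc m) * b ^ k - suc m ∣ < suc m

0<recip : ∀ q .{{_ : NonZero q}} → 0ℚ <ℚ recip q
0<recip (suc r) = ℚ.positive⁻¹ _ {{ℚ.normalize-pos 1 (suc r)}}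

normal⇒countNormal : ∀ {b} .{{_ : NonZero b}} (a : DigitSeq b) → Normal b a → CountNormal b a
normal⇒countNormal {b} a normal k d p
  with N , freq ← normal k d (recip (suc p * b ^ k)) (0<recip _ {{m*n≢0 (suc p) (b ^ k) {{_}} {{m^n≢0 b k}}}}) =
  N , λ m N≤m → frequency-<⇒count-< (occurrences a d (suc m)) m (b ^ k) p {{m^n≢0 b k}} (freq m N≤m)

countNormal⇒normal : ∀ {b} .{{_ : NonZero b}} (a : DigitSeq b) → CountNormal b a → Normal b a
countNormal⇒normal {b} a normal k d ε 0<ε with N , count ← normal k d (ℚ.denominator-1 ε) =
  N , λ m N≤m → count-<⇒frequency-< (occurrences a d (suc m)) m (b ^ k) ε {{m^n≢0 b k}} 0<ε (count m N≤m)

-- Uses 1 - 1/(t + 1) = t/(t + 1); the inequality is strict because `c` lies strictly above this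
-- value.
lowerDensity⇒count : ∀ {ν} t → LowerDensityGt ν (1ℚ - recip (suc t)) →
  Σ ℕ λ N → (m : ℕ) → N ≤ m → t * suc m < suc t * countUpTo ν (suc m)
lowerDensity⇒count {ν} t (c , 1-r<c , N , dense) = N , λ m N≤m →
  let M = countUpTo ν (suc m) in
  subst₂ _<_ (cong (_* suc m) (+-identityʳ t)) (trans (*-comm M _) (cong (_* M) (*-identityˡ (suc t))))
    -- Before normalisation, 1 - 1/(t + 1) computes to the fraction with numerator `t + 0` and
    -- denominator `1 * suc t`.
    (+*+< {t + 0} {suc m} {M} {1 * suc t} (ℚᵘ.drop-*<*
      (ℚᵘ.<-respˡ-≃ (ℚᵘ.≃-trans (toℚᵘ-homo-- 1ℚ (recip (suc t)))
          (ℚᵘ.+-congʳ (toℚᵘ 1ℚ) (ℚᵘ.-‿cong (ℚ.toℚᵘ-fromℚᵘ (mkℚᵘ (+ 1) t)))))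
        (ℚᵘ.<-respʳ-≃ (ℚ.toℚᵘ-fromℚᵘ (mkℚᵘ (+ M) m))
          (ℚ.toℚᵘ-mono-< (ℚ.<-≤-trans 1-r<c (dense m N≤m)))))))

-- Choice of constants and the final estimate.

theorem1p3 : (b : ℕ) → 2 ≤ b → (a : DigitSeq b) →
    ((ε : ℚ) → 0ℚ <ℚ ε →
    Σ (ℕ → ℕ) λ ν → IncreasingPos ν × LowerDensityGt ν (1ℚ - ε) × Normal b (subseq a ν)) →
    Normal b a
theorem1p3 b 2≤b a thin = countNormal⇒normal a countNormal
  where
  instance
    b≢0 : NonZero b
    b≢0 = >-nonZero (≤-trans (s≤s z≤n) 2≤b)

  countNormal : CountNormal b a
  countNormal k d p′ = extract (thin (recip (suc t)) (0<recip (suc t)))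
    where
    p q K T t C : ℕ
    p = suc p′
    q = b ^ k
    K = suc k
    -- `T` is the coefficient of the gap count G in p(qK(G + K) + E + G). The factor 3 in `t` and
    -- `C` splits the allowed error into three equal shares.
    T = p * q * K + p
    t = 3 * T
    C = 3 * (p * (q * (K * K)))

    extract : (Σ (ℕ → ℕ) λ ν → IncreasingPos ν × LowerDensityGt ν (1ℚ - recip (suc t)) × Normal b (subseq a ν)) →
      Σ ℕ λ N → (m : ℕ) → N ≤ m → p * ∣ occurrences a d (suc m) * q - suc m ∣ < suc m
    extract (ν , incr , density , normal)
      -- The successor of `2 + 3 * p′` is 3p, which makes the error of the subsequence smaller than
      -- M/(3p).
      with lowerDensity⇒count {ν} t density | normal⇒countNormal (subseq a ν) normal k d (2 + 3 * p′)
    -- `N₁` serves the density, `2 * suc N₂` makes M exceed `N₂`, and `C` absorbs the constant term.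
    ... | N₁ , dense | N₂ , close = N₁ ⊔ (2 * suc N₂ ⊔ C) , bound
      where
      open Thinning incr (λ m → inRange ν (suc m))
        (λ n → inRange-sound ν (suc n)) (λ n → inRange-complete incr (suc n))

      bound : ∀ m → N₁ ⊔ (2 * suc N₂ ⊔ C) ≤ m →
        p * ∣ occurrences a d (suc m) * q - suc m ∣ < suc m
      bound m N≤m = *-cancelˡ-< 3 _ _ (begin-strict
        3 * (p * ∣ o * q - n ∣)
          ≤⟨ *-monoʳ-≤ 3 (*-monoʳ-≤ p distance) ⟩
        3 * (p * (q * (K * (G + K)) + (E + G)))
          ≡⟨ rearrange p q K G E ⟩
        (C + t * G) + 3 * p * E
          -- One share of n each for the constant term, the gaps and the error of the subsequence;
          -- only the last is used strictly.
          <⟨ +-mono-≤-< (+-mono-≤ constant-small (≤-trans (<⇒≤ missed-few) M≤n)) (≤-trans sub-close M≤n) ⟩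
        n + n + n
          ≡⟨ thrice n ⟩
        3 * n ∎)
        where
        open ≤-Reasoning
        n M G o E : ℕ
        n = suc m
        M = kept n
        G = missed n
        o = occurrences a d n
        E = ∣ occurrences (subseq a ν) d M * q - M ∣

        thrice : ∀ x → x + x + x ≡ 3 * x
        thrice = solve-∀

        rearrange : ∀ x y z w v → 3 * (x * (y * (z * (w + z)) + (v + w))) ≡
          (3 * (x * (y * (z * z))) + 3 * (x * y * z + x) * w) + 3 * x * v
        rearrange = solve-∀

        M+G≡n : M + G ≡ n
        M+G≡n = kept+missed n

        M≤n : M ≤ n
        M≤n = subst (M ≤_) M+G≡n (m≤m+n M G)

        missed-few : t * G < M
        missed-few = +-cancelˡ-< (t * M) _ _ (begin-strict
          t * M + t * G    ≡⟨ *-distribˡ-+ t M G ⟨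
          t * (M + G)      ≡⟨ cong (t *_) M+G≡n ⟩
          t * n            <⟨ dense m (≤-trans (m≤m⊔n _ _) N≤m) ⟩
          M + t * M        ≡⟨ +-comm M _ ⟩
          t * M + M        ∎)

        t≢0 : NonZero t
        t≢0 = >-nonZero (≤-trans (≤-trans z<s (m≤n+m p (p * q * K))) (m≤n*m T 3))

        -- As t is positive, G ≤ tG < M, so at least half of the first n positions are kept.
        N₂<M : suc N₂ ≤ M
        N₂<M = *-cancelˡ-≤ 2 (begin
          2 * suc N₂       ≤⟨ ≤-trans (m≤m⊔n (2 * suc N₂) C) (≤-trans (m≤n⊔m N₁ _) N≤m) ⟩
          m                ≤⟨ n≤1+n m ⟩
          n                ≡⟨ M+G≡n ⟨
          M + G            ≤⟨ +-monoʳ-≤ M (≤-trans (m≤n*m G t {{t≢0}}) (<⇒≤ missed-few)) ⟩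
          M + M            ≡⟨ cong (_+_ M) (+-identityʳ M) ⟨
          2 * M            ∎)

        sub-close : 3 * p * E < M
        sub-close = close′ M N₂<M
          where
          -- `close` speaks of successors, and M is not one syntactically; hence the general j.
          close′ : ∀ j → suc N₂ ≤ j → 3 * p * ∣ occurrences (subseq a ν) d j * q - j ∣ < j
          close′ (suc j) (s≤s N₂≤j) = subst (λ x → x * ∣ occurrences (subseq a ν) d (suc j) * q - suc j ∣ < suc j)
            (sym (*-suc 3 p′)) (close j N₂≤j)

        constant-small : C ≤ n
        constant-small = ≤-trans (≤-trans (m≤n⊔m (2 * suc N₂) C) (m≤n⊔m N₁ _)) (m≤n⇒m≤1+n N≤m)

        -- The triangle inequality, passing through `o′ * q` and M.
        distance : ∣ o * q - n ∣ ≤ q * (K * (G + K)) + (E + G)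
        distance = begin
          ∣ o * q - n ∣
            ≤⟨ ∣-∣-triangle (o * q) (o′ * q) n ⟩
          ∣ o * q - o′ * q ∣ + ∣ o′ * q - n ∣
            ≤⟨ +-mono-≤ (≤-reflexive (trans (sym (*-distribʳ-∣-∣ q o o′)) (*-comm _ q))) (∣-∣-triangle (o′ * q) M n) ⟩
          q * ∣ o - o′ ∣ + (E + ∣ M - n ∣)
            ≤⟨ +-mono-≤ (*-monoʳ-≤ q (discrepancy-≤ a d n)) (+-monoʳ-≤ E (≤-reflexive M-n)) ⟩
          q * (K * (G + K)) + (E + G) ∎
          where
          o′ = occurrences (subseq a ν) d M
          M-n : ∣ M - n ∣ ≡ G
          M-n = trans (cong (∣_-_∣ M) (sym M+G≡n)) (∣m-m+n∣≡n M G)
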